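{- Let $n,m\ge 1$ be integers and let $D$ be a set with $|D|=n$. Let $g_1,\ldots,g_{n!}$ be the elements of $Sym(D)$, and for each $1\le r\le n!$ let $k_{r1},\ldots,k_{r\ell_r}$ be the cycle type of $g_r$. Then the number of $m$-endomorphisms on $D^+$, up to combinatorial equivalence (i.e. the number of combinatorial equivalence classes of $m$-endomorphisms on $D^+$), is $$\frac{1}{n!}\sum_{r=1}^{n!}\Bigg(\prod_{i=1}^{\ell_r}\bigg(\sum_{k=1}^m\Big(\sum_{j\mid k_{ri}}j\,c(g_r,j)\Big)^k\bigg)\Bigg),$$ where the innermost sum is over the positive divisors $j$ of $k_{ri}$.
   Context: $D^+$ is the free semigroup on $D$: the set of all finite strings $d_1\ldots d_k$ ($k\ge 1$, $d_i\in D$) under concatenation; $|W|$ denotes the length of a string $W$. An endomorphism on $D^+$ is a map $\phi:D^+\to D^+$ with $\phi(W_1W_2)=\phi(W_1)\phi(W_2)$ for all $W_1,W_2\in D^+$. Any map $f:D\to D^+$ extends uniquely to an endomorphism $\phi_f$, given by $\phi_f(d_1\ldots d_k)=f(d_1)\ldots f(d_k)$. An $m$-endomorphism on $D^+$ is an endomorphism $\phi$ with $|\phi(d)|\le m$ for all $d\in D$. Two $m$-endomorphisms $\phi,\psi$ on $D^+$ are combinatorially equivalent if there is a bijection $g:D\to D$ such that $\psi\circ\phi_g=\phi_g\circ\phi$ (this is an equivalence relation). $Sym(D)$ is the group of all bijections $D\to D$. If $g\in Sym(D)$ is the product of disjoint cycles of lengths $k_1\le k_2\le\cdots\le k_\ell$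 (fixed points counted as cycles of length 1), then the sequence $k_1,\ldots,k_\ell$ is the cycle type of $g$. For a positive integer $j$, $c(g,j)$ is the number of cycles of length $j$ in the cycle decomposition of $g$. -}

module Defs where

open import Level using (Level)
open import Data.List.Base as List using (List; applyUpTo; filter; tabulate)
open import Data.List.Membership.Propositional using (_∈_)
open import Data.List.NonEmpty as List⁺
  using (List⁺; _∷_; [_]; _⁺++⁺_; _∷ʳ_; head; tail; toList)
open import Data.List.NonEmpty.Properties using (map-id; map-cong; map-∘)
open import Data.List.Relation.Unary.Sorted.TotalOrder using (Sorted)
open import Data.List.Relation.Unary.Unique.Propositional using (Unique)
open import Data.Fin.Base using (Fin)
open import Data.Nat.Base using (ℕ; suc; _≤_)
open import Data.Nat.Divisibility using (_∣?_)
open import Data.Nat.ListAction using (sum; product)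
open import Data.Nat.Properties using (_≟_; ≤-totalOrder)
open import Data.Product.Base using (∃-syntax; _,_)
open import Function.Base using (_∘_; id)
open import Function.Bundles using (_↔_; Inverse)
open import Function.Construct.Composition using (_↔-∘_)
open import Function.Construct.Identity using (↔-id)
open import Function.Construct.Symmetry using (↔-sym)
open import Relation.Binary.Bundles using (Setoid)
open import Relation.Binary.PropositionalEquality
  using (_≡_; _≗_; refl; sym; trans; cong; module ≡-Reasoning)

open Inverse using (to; from; strictlyInverseˡ; strictlyInverseʳ)

private
  variable
    a : Level
    D : Set a

-- The free semigroup D⁺ is List⁺ D under _⁺++⁺_.

record MEndomorphism (m : ℕ) (D : Set a) : Set a where
  field
    ⟦_⟧     : List⁺ D → List⁺ D
    homo    : ∀ W₁ W₂ → ⟦ W₁ ⁺++⁺ W₂ ⟧ ≡ ⟦ W₁ ⟧ ⁺++⁺ ⟦ W₂ ⟧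
    bounded : ∀ d → List⁺.length ⟦ [ d ] ⟧ ≤ m

open MEndomorphism public

extend : (D → List⁺ D) → List⁺ D → List⁺ D
extend = List⁺.concatMap

-- φ_g for a bijection g, whose values are read as strings of length 1.
letterwise : D ↔ D → List⁺ D → List⁺ D
letterwise g = extend ([_] ∘ to g)

CombEquiv : (m : ℕ) (D : Set a) → MEndomorphism m D → MEndomorphism m D → Set a
CombEquiv m D φ ψ = ∃[ g ] ⟦ ψ ⟧ ∘ letterwise g ≗ letterwise g ∘ ⟦ φ ⟧

letterwise≗map : (g : D ↔ D) → letterwise g ≗ List⁺.map (to g)
letterwise≗map g (x ∷ xs) = cong (to g x ∷_) (go xs)
  where
  go : ∀ ys → List.concat (List.map toList (List.map ([_] ∘ to g) ys)) ≡ List.map (to g) ys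
  go List.[]       = refl
  go (y List.∷ ys) = cong (to g y List.∷_) (go ys)

private
  map-inverse : {f : D → D} {h : D → D} → f ∘ h ≗ id → List⁺.map f ∘ List⁺.map h ≗ id
  map-inverse {f = f} {h} eq W =
    trans (sym (map-∘ {g = f} {f = h} W)) (trans (map-cong eq W) (map-id W))

  module _ {m : ℕ} {D : Set a} where

    MapEquiv : (D ↔ D) → MEndomorphism m D → MEndomorphism m D → Set a
    MapEquiv g φ ψ = ⟦ ψ ⟧ ∘ List⁺.map (to g) ≗ List⁺.map (to g) ∘ ⟦ φ ⟧

    toMap : ∀ g φ ψ → ⟦ ψ ⟧ ∘ letterwise g ≗ letterwise g ∘ ⟦ φ ⟧ → MapEquiv g φ ψ
    toMap g φ ψ eq W =
      trans (cong ⟦ ψ ⟧ (sym (letterwise≗map g W))) (trans (eq W) (letterwise≗map g _))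

    fromMap : ∀ g φ ψ → MapEquiv g φ ψ → ⟦ ψ ⟧ ∘ letterwise g ≗ letterwise g ∘ ⟦ φ ⟧
    fromMap g φ ψ eq W =
      trans (cong ⟦ ψ ⟧ (letterwise≗map g W)) (trans (eq W) (sym (letterwise≗map g _)))

    ~-refl : ∀ {φ} → CombEquiv m D φ φ
    ~-refl {φ} = ↔-id D , fromMap (↔-id D) φ φ
      (λ W → trans (cong ⟦ φ ⟧ (map-id W)) (sym (map-id _)))

    ~-sym : ∀ {φ ψ} → CombEquiv m D φ ψ → CombEquiv m D ψ φ
    ~-sym {φ} {ψ} (g , eq) = ↔-sym g , fromMap (↔-sym g) ψ φ λ W → begin
      ⟦ φ ⟧ (g⁻¹ W)               ≡⟨ map-inverse (strictlyInverseʳ g) _ ⟨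
      g⁻¹ (gᵐ (⟦ φ ⟧ (g⁻¹ W)))    ≡⟨ cong g⁻¹ (toMap g φ ψ eq _) ⟨
      g⁻¹ (⟦ ψ ⟧ (gᵐ (g⁻¹ W)))    ≡⟨ cong (g⁻¹ ∘ ⟦ ψ ⟧) (map-inverse (strictlyInverseˡ g) W) ⟩
      g⁻¹ (⟦ ψ ⟧ W)               ∎
      where
      open ≡-Reasoning
      gᵐ g⁻¹ : List⁺ D → List⁺ D
      gᵐ  = List⁺.map (to g)
      g⁻¹ = List⁺.map (from g)

    ~-trans : ∀ {φ ψ χ} → CombEquiv m D φ ψ → CombEquiv m D ψ χ → CombEquiv m D φ χ
    ~-trans {φ} {ψ} {χ} (g , eq₁) (h , eq₂) = h ↔-∘ g , fromMap (h ↔-∘ g) φ χ λ W → begin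
      ⟦ χ ⟧ (List⁺.map (to h ∘ to g) W)              ≡⟨ cong ⟦ χ ⟧ (map-∘ W) ⟩
      ⟦ χ ⟧ (List⁺.map (to h) (List⁺.map (to g) W))  ≡⟨ toMap h ψ χ eq₂ _ ⟩
      List⁺.map (to h) (⟦ ψ ⟧ (List⁺.map (to g) W))  ≡⟨ cong (List⁺.map (to h)) (toMap g φ ψ eq₁ W) ⟩
      List⁺.map (to h) (List⁺.map (to g) (⟦ φ ⟧ W))  ≡⟨ map-∘ _ ⟨
      List⁺.map (to h ∘ to g) (⟦ φ ⟧ W)              ∎
      where open ≡-Reasoning

-- As a setoid, its elements are the combinatorial equivalence classes.
EndomorphismClasses : ℕ → Set a → Setoid a a
EndomorphismClasses m D = record
  { Carrier       = MEndomorphism m D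
  ; _≈_           = CombEquiv m D
  ; isEquivalence = record
    { refl  = λ {φ} → ~-refl {φ = φ}
    ; sym   = λ {φ} {ψ} → ~-sym {φ = φ} {ψ}
    ; trans = λ {φ} {ψ} {χ} → ~-trans {φ = φ} {ψ} {χ}
    }
  }

-- Bijections are identified when they agree as functions.
Sym : Set a → Setoid a a
Sym D = record
  { Carrier       = D ↔ D
  ; _≈_           = λ g h → to g ≗ to h
  ; isEquivalence = record
    { refl  = λ _ → refl
    ; sym   = λ p d → sym (p d)
    ; trans = λ p q d → trans (p d) (q d)
    }
  }

-- The string d₁ d₂ … dₖ is read as the cycle d₁ ↦ d₂ ↦ ⋯ ↦ dₖ ↦ d₁.
IsCycle : D ↔ D → List⁺ D → Set _
IsCycle g c = List⁺.map (to g) c ≡ tail c ∷ʳ head c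

-- Fixed points are cycles of length 1, so every element of D occurs in
-- exactly one cycle, exactly once.
record CycleDecomposition {D : Set a} (g : D ↔ D) : Set a where
  field
    cycles   : List (List⁺ D)
    areCycle : ∀ {c} → c ∈ cycles → IsCycle g c
    disjoint : Unique (List.concatMap toList cycles)
    covering : ∀ d → d ∈ List.concatMap toList cycles

  cycleType : List ℕ
  cycleType = List.map List⁺.length cycles

  field
    ordered : Sorted ≤-totalOrder cycleType

  -- c(g, j)
  count : ℕ → ℕ
  count j = List.length (filter (λ c → List⁺.length c ≟ j) cycles)

open CycleDecomposition public using (cycleType; count)

-- ∑[1≤k≤ m ] f is f 1 + ⋯ + f m.
∑[1≤k≤_] : ℕ → (ℕ → ℕ) → ℕ
∑[1≤k≤ m ] f = sum (applyUpTo (f ∘ suc) m)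

divisors : ℕ → List ℕ
divisors k = filter (_∣? k) (applyUpTo suc k)

∑∣ : ℕ → (ℕ → ℕ) → ℕ
∑∣ k f = sum (List.map f (divisors k))

∏∈ : List ℕ → (ℕ → ℕ) → ℕ
∏∈ ks f = product (List.map f ks)

∑Fin : (n : ℕ) → (Fin n → ℕ) → ℕ
∑Fin n f = sum (tabulate f)

-- An m-endomorphism is determined by its values on letters, so the classes are the orbits of
-- Sym(D) acting by g · f = g ∘ f ∘ g⁻¹ on the maps f from D to the strings of length at most m,
-- and Burnside's lemma counts them. A map f is fixed by g iff it commutes with g; it is then
-- determined by its values at one letter of each cycle, where the value at a cycle of length k
-- can be any string fixed by gᵏ, i.e. any string in the letters fixed by gᵏ. These letters are
-- the ones lying on cycles whose length j divides k, so there are ∑_{j ∣ k} j c(g, j) of them.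

module Submission where

open import Defs
open import Algebra.Bundles using (Group)
open import Data.Empty using (⊥-elim)
open import Data.Fin.Base using (Fin; zero; suc)
open import Data.Fin.Permutation using (↔⇒≡)
open import Data.Fin.Properties using (+↔⊎; *↔×; any?; inj⇒≟) renaming (_≟_ to _≟ᶠ_)
open import Data.Integer.Base as ℤ using (+_)
import Data.Integer.Properties as ℤ
open import Data.List.Base as List
  using (List; []; _∷_; _++_; applyUpTo; filter; length; lookup; tabulate)
open import Data.List.Membership.Propositional using (_∈_; _∉_)
open import Data.List.Membership.Propositional.Properties
  using (∈-applyUpTo⁺; ∈-concatMap⁺; ∈-concatMap⁻; ∈-filter⁺; ∈-filter⁻; ∈-lookup)
open import Data.List.NonEmpty as List⁺
  using (List⁺; _∷_; [_]; head; tail; toList; _⁺++⁺_; _⁺++_)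
open import Data.List.NonEmpty.Properties
  using (length-map; map-cong; map-id; map-⁺++⁺) renaming (map-∘ to map⁺-∘)
open import Data.List.Properties
  using (++-assoc; ++-identityʳ; filter-++; filter-accept; filter-all; filter-none; filter-reject;
         length-++; map-cong-local; map-tabulate; map-∘; tabulate-lookup; ∷-injective; ∷-injectiveˡ)
open import Data.List.Relation.Unary.All as All using (All; []; _∷_)
import Data.List.Relation.Unary.All.Properties as All
open import Data.List.Relation.Unary.AllPairs using ([]; _∷_)
open import Data.List.Relation.Unary.Any as Any using (here; there; index)
open import Data.List.Relation.Unary.Any.Properties using (lookup-index)
open import Data.List.Relation.Unary.Unique.Propositional using (Unique)
import Data.List.Relation.Unary.Unique.Propositional.Properties as Unique
open import Data.Nat.Base
  using (ℕ; zero; suc; _+_; _*_; _^_; _∸_; _≤_; _<_; _!; z≤n; s≤s; NonZero)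
open import Data.Nat.Divisibility using (_∣_; _∣?_; divides; ∣⇒≤; m%n≡0⇒n∣m)
open import Data.Nat.DivMod using (_%_; _/_; m≡m%n+[m/n]*n; m%n<n)
open import Data.Nat.GeneralisedArithmetic using (fold; fold-+)
open import Data.Nat.ListAction using (sum; product)
open import Data.Nat.Properties
  using (_!≢0; +-assoc; +-comm; *-distribˡ-+; *-identityʳ; *-suc; *-zeroʳ; m+[n∸m]≡n;
         suc-injective; <⇒≢; ≤-reflexive; ≤-total; ≤-trans)
  renaming (_≟_ to _≟ᴺ_)
open import Data.Product.Base using (∃-syntax; _×_; _,_; proj₁; proj₂; uncurry)
open import Data.Product.Function.NonDependent.Setoid using (_×-inverse_)
open import Data.Product.Relation.Binary.Pointwise.NonDependent as × using (_×ₛ_)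
open import Data.Rational.Base as ℚ using (ℚ; toℚᵘ)
import Data.Rational.Properties as ℚ
open import Data.Rational.Unnormalised.Base as ℚᵘ using (mkℚᵘ; *≡*)
import Data.Rational.Unnormalised.Properties as ℚᵘ
open import Data.Sum.Base using (inj₁; inj₂)
open import Data.Sum.Function.Setoid using (_⊎-inverse_)
open import Data.Sum.Relation.Binary.Pointwise as ⊎ using (_⊎ₛ_; inj₁; inj₂)
open import Data.Unit.Base using (⊤; tt)
open import Function.Base using (_∘_; id)
open import Function.Bundles using (_↔_; Bijection; Inverse)
open import Function.Consequences.Setoid
  using (strictlyInverseˡ⇒inverseˡ; strictlyInverseʳ⇒inverseʳ)
open import Function.Construct.Composition using (_↔-∘_)
open import Function.Construct.Identity using (↔-id)
open import Function.Construct.Symmetry using (↔-sym)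
open import Function.Properties.Bijection using (Bijection⇒Inverse)
import Function.Properties.Inverse as Inv
open import Level using (Level; _⊔_)
open import Relation.Binary.Bundles using (Setoid)
import Relation.Binary.Construct.On as On
open import Relation.Binary.Core using (Rel)
open import Relation.Binary.Definitions using (DecidableEquality) renaming (Decidable to Decidable₂)
open import Relation.Binary.PropositionalEquality
  using (_≡_; _≢_; _≗_; refl; sym; trans; cong; cong₂; subst; setoid; module ≡-Reasoning)
import Relation.Binary.Reasoning.Setoid as ≈-Reasoning
open import Relation.Binary.Structures using (IsEquivalence)
open import Relation.Nullary.Decidable using (Dec; yes; no; map′)
open import Relation.Nullary.Negation using (contradiction)
open import Relation.Unary using (Decidable)

open Setoid using (Carrier)

-- Maps and bijections are compared pointwise, and members of a subset without regard to the proof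
-- of membership. Counting therefore takes place in setoids: a size is a setoid bijection with
-- `Fin k`, and every map built on the way has to respect the equalities.
--
-- That a number of classes exists at all needs an argument: orbits can be enumerated once it is
-- decidable whether two points share an orbit. This follows from the given enumeration of Sym(D)
-- and the finiteness of the set acted on, which is itself one of the fixed-point counts, namely
-- that of the identity.
--
-- A letter on a cycle is the head after i steps, but i is determined only modulo the length of the
-- cycle. Spreading a value from the head along the cycle is thus well defined exactly when the
-- value returns to itself after one full turn.
--
-- The sum of powers in the formula counts the nonempty strings of length at most m over the letters
-- fixed by the k-th power of g.

private
  variable
    a b c ℓ ℓ₁ ℓ₂ p q : Level
    A B D : Set a

-- Cardinalities of setoids

_HasSize_ : Setoid a ℓ → ℕ → Set (a ⊔ ℓ)
S HasSize k = Inverse S (setoid (Fin k))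

-- Equality looks only at first components, so an element is counted once, however many proofs of
-- `P` it has.
_∣ₛ_ : (S : Setoid a ℓ) → (Carrier S → Set p) → Setoid (a ⊔ p) ℓ
S ∣ₛ P = On.setoid S (proj₁ {B = P})

_⇒ₛ_ : Set a → Setoid b ℓ → Setoid (a ⊔ b) (a ⊔ ℓ)
A ⇒ₛ S = record
  { Carrier = A → Carrier S
  ; _≈_ = λ f h → ∀ x → f x ≈ h x
  ; isEquivalence = record
    { refl = λ _ → S.refl ; sym = λ p x → S.sym (p x) ; trans = λ p q x → S.trans (p x) (q x) }
  }
  where module S = Setoid S ; open S using (_≈_)

module _ (S : Setoid a ℓ₁) (T : Setoid b ℓ₂) where
  private
    module S = Setoid S
    module T = Setoid T

  mkInverse : (to : S.Carrier → T.Carrier) (from : T.Carrier → S.Carrier) →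
    (∀ {x y} → x S.≈ y → to x T.≈ to y) → (∀ {x y} → x T.≈ y → from x S.≈ from y) →
    (∀ y → to (from y) T.≈ y) → (∀ x → from (to x) S.≈ x) → Inverse S T
  mkInverse to from to-cong from-cong invˡ invʳ = record
    { to = to ; from = from ; to-cong = to-cong ; from-cong = from-cong
    ; inverse = strictlyInverseˡ⇒inverseˡ S T to-cong invˡ
              , strictlyInverseʳ⇒inverseʳ S T from-cong invʳ }

module _ (S : Setoid a ℓ) {P : Carrier S → Set p} {Q : Carrier S → Set q} where

  subset-⇔ : (∀ x → P x → Q x) → (∀ x → Q x → P x) → Inverse (S ∣ₛ P) (S ∣ₛ Q)
  subset-⇔ P⇒Q Q⇒P = mkInverse (S ∣ₛ P) (S ∣ₛ Q)
    (λ (x , px) → x , P⇒Q x px) (λ (x , qx) → x , Q⇒P x qx)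
    id id (λ _ → Setoid.refl S) (λ _ → Setoid.refl S)

size-unique : ∀ {S : Setoid a ℓ} {k l} → S HasSize k → S HasSize l → k ≡ l
size-unique s t = ↔⇒≡ (Inv.trans (Inv.sym s) t)

size-× : ∀ {S : Setoid a ℓ₁} {T : Setoid b ℓ₂} {k l} →
         S HasSize k → T HasSize l → (S ×ₛ T) HasSize (k * l)
size-× s t = Inv.trans (s ×-inverse t) (Inv.trans ×.Pointwise-≡↔≡ (Inv.sym *↔×))

size-⊎ : ∀ {S : Setoid a ℓ₁} {T : Setoid b ℓ₂} {k l} →
         S HasSize k → T HasSize l → (S ⊎ₛ T) HasSize (k + l)
size-⊎ s t = Inv.trans (s ⊎-inverse t) (Inv.trans (⊎.Pointwise-≡↔≡ _ _) (Inv.sym +↔⊎))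

module _ (X : Setoid a ℓ) where
  private module X = Setoid X

  -- A disjoint union of subsets of the single setoid `X`, placed inside `Fin n` times `X` so that
  -- no equality has to be transported between fibres.
  Pairs : ∀ n → (Fin n → X.Carrier → Set p) → Setoid _ _
  Pairs n P = (setoid (Fin n) ×ₛ X) ∣ₛ uncurry P

  size-Σ : ∀ n {P : Fin n → X.Carrier → Set p} (k : Fin n → ℕ) →
           (∀ i → (X ∣ₛ P i) HasSize k i) → Pairs n P HasSize ∑Fin n k
  size-Σ zero {P} k s = mkInverse (Pairs zero P) (setoid (Fin 0))
    (λ { ((() , _) , _) }) (λ ()) (λ { {(() , _) , _} }) (λ { {()} }) (λ ()) (λ { ((() , _) , _) })
  size-Σ (suc n) {P} k s =
    Inv.trans split (size-⊎ (s zero) (size-Σ n (k ∘ suc) (s ∘ suc)))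
    where
    Rest = Pairs n (P ∘ suc)
    to : Carrier (Pairs (suc n) P) → Carrier ((X ∣ₛ P zero) ⊎ₛ Rest)
    to ((zero , x) , px)  = inj₁ (x , px)
    to ((suc i , x) , px) = inj₂ ((i , x) , px)
    from : Carrier ((X ∣ₛ P zero) ⊎ₛ Rest) → Carrier (Pairs (suc n) P)
    from (inj₁ (x , px))       = (zero , x) , px
    from (inj₂ ((i , x) , px)) = (suc i , x) , px
    split : Inverse (Pairs (suc n) P) ((X ∣ₛ P zero) ⊎ₛ Rest)
    split = mkInverse _ _ to from
      (λ { {(zero , _) , _} (refl , e) → inj₁ e ; {(suc _ , _) , _} (refl , e) → inj₂ (refl , e) })
      (λ { (inj₁ e) → refl , e ; (inj₂ (refl , e)) → refl , e })
      (λ { (inj₁ _) → inj₁ X.refl ; (inj₂ _) → inj₂ (refl , X.refl) })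
      (λ { ((zero , _) , _) → refl , X.refl ; ((suc _ , _) , _) → refl , X.refl })

  Choices : ∀ n → (Fin n → X.Carrier → Set p) → Setoid _ _
  Choices n P = (Fin n ⇒ₛ X) ∣ₛ (λ t → ∀ i → P i (t i))

  size-Π : ∀ n {P : Fin n → X.Carrier → Set p} (k : Fin n → ℕ) →
           (∀ i → (X ∣ₛ P i) HasSize k i) → Choices n P HasSize product (tabulate k)
  size-Π zero {P} k s = mkInverse (Choices zero P) (setoid (Fin 1))
    (λ _ → zero) (λ _ → (λ ()) , (λ ())) (λ _ → refl) (λ _ ()) (λ { zero → refl }) (λ _ ())
  size-Π (suc n) {P} k s =
    Inv.trans split (size-× (s zero) (size-Π n {P ∘ suc} (k ∘ suc) (s ∘ suc)))
    where
    Rest = Choices n (P ∘ suc)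
    to : Carrier (Choices (suc n) P) → Carrier ((X ∣ₛ P zero) ×ₛ Rest)
    to (t , pt) = (t zero , pt zero) , (t ∘ suc , pt ∘ suc)
    from : Carrier ((X ∣ₛ P zero) ×ₛ Rest) → Carrier (Choices (suc n) P)
    from ((x , px) , (t , pt)) =
      (λ { zero → x ; (suc i) → t i }) , (λ { zero → px ; (suc i) → pt i })
    split : Inverse (Choices (suc n) P) ((X ∣ₛ P zero) ×ₛ Rest)
    split = mkInverse _ _ to from
      (λ e → e zero , e ∘ suc)
      (λ { (e , es) → λ { zero → e ; (suc i) → es i } })
      (λ _ → X.refl , λ _ → X.refl)
      (λ { _ zero → X.refl ; _ (suc i) → X.refl })

-- Remove the element zero and count the classes of the rest. Either zero is related to some `suc i`
-- and joins that class, or it forms one new class by itself.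
size-Fin/~ : ∀ n {_~_ : Rel (Fin n) ℓ} (E : IsEquivalence _~_) → Decidable₂ _~_ →
             ∃[ N ] record { isEquivalence = E } HasSize N
size-Fin/~ zero {_~_} E _~?_ = 0 , mkInverse (record { isEquivalence = E }) (setoid (Fin 0))
  id id (λ { {()} }) (λ { {()} }) (λ ()) (λ ())
size-Fin/~ (suc n) {_~_} E _~?_
  with size-Fin/~ n (On.isEquivalence suc E) (λ i j → suc i ~? suc j) | any? (λ i → zero ~? suc i)
... | N , tail | yes (i , 0~i) = N , mkInverse S (setoid (Fin N)) to (suc ∘ T.from) to-cong
      (λ { refl → E.refl }) T.strictlyInverseˡ
      (λ { zero → E.trans (T.strictlyInverseʳ i) (E.sym 0~i) ; (suc j) → T.strictlyInverseʳ j })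
  where
  S = record { isEquivalence = E }
  module E = IsEquivalence E
  module T = Inverse tail
  to : Fin (suc n) → Fin N
  to zero    = T.to i
  to (suc j) = T.to j
  to-cong : ∀ {j k} → j ~ k → to j ≡ to k
  to-cong {zero}  {zero}  _ = refl
  to-cong {zero}  {suc k} e = T.to-cong (E.trans (E.sym 0~i) e)
  to-cong {suc j} {zero}  e = T.to-cong (E.trans e 0~i)
  to-cong {suc j} {suc k} e = T.to-cong e
... | N , tail | no 0≁ = suc N , mkInverse S (setoid (Fin (suc N))) to from to-cong
      (λ { refl → E.refl })
      (λ { zero → refl ; (suc j) → cong suc (T.strictlyInverseˡ j) })
      (λ { zero → E.refl ; (suc j) → T.strictlyInverseʳ j })
  where
  S = record { isEquivalence = E }
  module E = IsEquivalence E
  module T = Inverse tail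
  to : Fin (suc n) → Fin (suc N)
  to zero    = zero
  to (suc j) = suc (T.to j)
  from : Fin (suc N) → Fin (suc n)
  from zero    = zero
  from (suc j) = suc (T.from j)
  to-cong : ∀ {j k} → j ~ k → to j ≡ to k
  to-cong {zero}  {zero}  _ = refl
  to-cong {zero}  {suc k} e = ⊥-elim (0≁ (k , e))
  to-cong {suc j} {zero}  e = ⊥-elim (0≁ (j , E.sym e))
  to-cong {suc j} {suc k} e = cong suc (T.to-cong e)

module _ {X : Setoid a ℓ₁} {M : ℕ} (X-size : X HasSize M) where
  private
    module X = Setoid X
    module C = Inverse X-size

  size⇒dec : Decidable₂ X._≈_
  size⇒dec x y = map′
    (λ e → X.trans (X.sym (C.strictlyInverseʳ x)) (X.trans (C.from-cong e) (C.strictlyInverseʳ y)))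
    C.to-cong (C.to x ≟ᶠ C.to y)

  size-/~ : ∀ {_~_ : Rel X.Carrier ℓ₂} (E : IsEquivalence _~_) → (∀ {x y} → x X.≈ y → x ~ y) →
            Decidable₂ _~_ → ∃[ N ] record { isEquivalence = E } HasSize N
  size-/~ {_~_ = _~_} E ≈⇒~ _~?_ =
    let N , s = size-Fin/~ M (On.isEquivalence C.from E) (λ i j → C.from i ~? C.from j)
    in  N , Inv.trans code s
    where
    module E = IsEquivalence E
    back : ∀ x → C.from (C.to x) ~ x
    back x = ≈⇒~ (C.strictlyInverseʳ x)
    code : Inverse (record { isEquivalence = E }) (On.setoid (record { isEquivalence = E }) C.from)
    code = mkInverse _ _ C.to C.from
      (λ {x} {y} e → E.trans (back x) (E.trans e (E.sym (back y)))) id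
      (λ i → back (C.from i)) back

-- Burnside's lemma

module Burnside
  (G : Group c ℓ₁) (X : Setoid a ℓ₂) (_·_ : Group.Carrier G → Carrier X → Carrier X)
  (·-cong : ∀ {g h x y} → Group._≈_ G g h → Setoid._≈_ X x y → Setoid._≈_ X (g · x) (h · y))
  (·-identity : ∀ x → Setoid._≈_ X (Group.ε G · x) x)
  (·-assoc : ∀ g h x → Setoid._≈_ X (Group._∙_ G g h · x) (g · (h · x)))
  where

  open Group G using (_∙_; ε; _⁻¹; inverseˡ; inverseʳ; ∙-congˡ; ∙-congʳ; assoc; identityʳ)
    renaming (_≈_ to _≈ᴳ_)
  private
    module G = Group G
    module X = Setoid X
  open X using (_≈_)

  Fix : G.Carrier → Setoid _ _
  Fix g = X ∣ₛ (λ x → g · x ≈ x)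

  inverse-· : ∀ {g x y} → g · x ≈ y → (g ⁻¹) · y ≈ x
  inverse-· {g} {x} {y} e = begin
    (g ⁻¹) · y        ≈⟨ ·-cong G.refl e ⟨
    (g ⁻¹) · (g · x)  ≈⟨ ·-assoc _ _ _ ⟨
    (g ⁻¹ ∙ g) · x    ≈⟨ ·-cong (inverseˡ g) X.refl ⟩
    ε · x             ≈⟨ ·-identity x ⟩
    x                 ∎
    where open ≈-Reasoning X

  ∙-· : ∀ {g h x y z} → h · x ≈ y → g · y ≈ z → (g ∙ h) · x ≈ z
  ∙-· e e′ = X.trans (·-assoc _ _ _) (X.trans (·-cong G.refl e) e′)

  Orbits : Setoid _ _
  Orbits = record
    { Carrier = X.Carrier
    ; _≈_ = λ x y → ∃[ g ] g · x ≈ y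
    ; isEquivalence = record
      { refl  = ε , ·-identity _
      ; sym   = λ (g , e) → (g ⁻¹) , inverse-· e
      ; trans = λ (g , e) (h , e′) → h ∙ g , ∙-· e e′
      }
    }

  module _ {K} (G-size : G.setoid HasSize K) (k : Fin K → ℕ)
           (Fix-size : ∀ r → Fix (Inverse.from G-size r) HasSize k r) where
    private
      module E = Inverse G-size

      -- The identity fixes every point, so the whole set is one of the fixed-point sets whose sizes
      -- are given. The enumeration returns the identity only up to equality in the group, hence the
      -- rewriting.
      X-size : X HasSize k (E.to ε)
      X-size = Inv.trans (mkInverse X (Fix (E.from (E.to ε)))
        (λ x → x , X.trans (·-cong (E.strictlyInverseʳ ε) X.refl) (·-identity x)) proj₁
        id id (λ _ → X.refl) (λ _ → X.refl)) (Fix-size (E.to ε))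

      -- A finite search through the group, with equality of points decided by their numbers.
      _~?_ : Decidable₂ (Setoid._≈_ Orbits)
      x ~? y = map′ (λ (r , e) → E.from r , e)
        (λ (g , e) → E.to g , X.trans (·-cong (E.strictlyInverseʳ g) X.refl) e)
        (any? (λ r → size⇒dec X-size (E.from r · x) y))

      ≈⇒~ : ∀ {x y} → x ≈ y → Setoid._≈_ Orbits x y
      ≈⇒~ e = ε , X.trans (·-identity _) e

    -- Let h x carry the representative of the orbit of x to x. Then (r , x) ↦ (orbit of x , g_r h x)
    -- is a bijection from the pairs with g_r x = x to X/G × G.
    burnside : ∃[ N ] Orbits HasSize N × N * K ≡ ∑Fin K k
    burnside = let N , Orbits-size = size-/~ X-size (Setoid.isEquivalence Orbits) ≈⇒~ _~?_
               in  N , Orbits-size , orbits*order Orbits-size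
      where
      module C = Inverse X-size

      Pairs′ : Setoid _ _
      Pairs′ = Pairs X K (λ r x → E.from r · x ≈ x)

      module _ {N} (Orbits-size : Orbits HasSize N) where
        module Q = Inverse Orbits-size

        -- h is read off canon x rather than x, since the choice of a group element for x
        -- need not respect ≈.
        canon : X.Carrier → X.Carrier
        canon x = C.from (C.to x)

        h : X.Carrier → G.Carrier
        h x = proj₁ (Q.strictlyInverseʳ (canon x))

        h-cong : ∀ {x y} → x ≈ y → h x ≈ᴳ h y
        h-cong e = G.reflexive (cong (λ i → proj₁ (Q.strictlyInverseʳ (C.from i))) (C.to-cong e))

        rep : X.Carrier → X.Carrier
        rep x = Q.from (Q.to x)

        h-rep : ∀ x → h x · rep x ≈ x
        h-rep x = begin
          h x · rep x          ≡⟨ cong (λ i → h x · Q.from i) (Q.to-cong (≈⇒~ (C.strictlyInverseʳ x))) ⟨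
          h x · rep (canon x)  ≈⟨ proj₂ (Q.strictlyInverseʳ (canon x)) ⟩
          canon x              ≈⟨ C.strictlyInverseʳ x ⟩
          x                    ∎
          where open ≈-Reasoning X

        to : Carrier Pairs′ → Fin N × Fin K
        to ((r , x) , _) = Q.to x , E.to (E.from r ∙ h x)

        -- If `s` numbers g_r h x with g_r x = x, then g_r h x carries the representative of the
        -- orbit to g_r x = x. Hence `x` is recovered from its orbit and `s`, and g_r is then
        -- obtained by cancelling h x.
        point : Fin N → Fin K → X.Carrier
        point i s = E.from s · Q.from i

        Q-point : ∀ i s → Q.to (point i s) ≡ i
        Q-point i s = trans (Q.to-cong (Setoid.sym Orbits (E.from s , X.refl))) (Q.strictlyInverseˡ i)

        from : Fin N × Fin K → Carrier Pairs′
        from (i , s) = (E.to (E.from s ∙ h (point i s) ⁻¹) , point i s) ,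
          -- The inverse of `h` takes the point back to the representative of its orbit, and
          -- `E.from s` carries this to the point again.
          X.trans (·-cong (E.strictlyInverseʳ _) X.refl)
            (∙-· (inverse-· (h-rep (point i s))) (X.reflexive (cong (λ j → point j s) (Q-point i s))))

        to∘from : ∀ y → Setoid._≈_ (setoid (Fin N) ×ₛ setoid (Fin K)) (to (from y)) y
        to∘from (i , s) = Q-point i s , trans (E.to-cong (begin
          E.from (E.to (E.from s ∙ h x ⁻¹)) ∙ h x  ≈⟨ ∙-congʳ (E.strictlyInverseʳ _) ⟩
          (E.from s ∙ h x ⁻¹) ∙ h x                ≈⟨ assoc _ _ _ ⟩
          E.from s ∙ (h x ⁻¹ ∙ h x)                ≈⟨ ∙-congˡ (inverseˡ (h x)) ⟩
          E.from s ∙ ε                             ≈⟨ identityʳ _ ⟩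
          E.from s                                 ∎)) (E.strictlyInverseˡ s)
          where
          x = point i s
          open ≈-Reasoning G.setoid

        from∘to : ∀ y → Setoid._≈_ Pairs′ (from (to y)) y
        from∘to ((r , x) , fixed) = trans (E.to-cong (begin
          E.from (E.to (E.from r ∙ h x)) ∙ h x′ ⁻¹  ≈⟨ ∙-congʳ (E.strictlyInverseʳ _) ⟩
          (E.from r ∙ h x) ∙ h x′ ⁻¹                ≈⟨ ∙-congˡ (G.⁻¹-cong (h-cong x′≈x)) ⟩
          (E.from r ∙ h x) ∙ h x ⁻¹                 ≈⟨ assoc _ _ _ ⟩
          E.from r ∙ (h x ∙ h x ⁻¹)                 ≈⟨ ∙-congˡ (inverseʳ (h x)) ⟩
          E.from r ∙ ε                              ≈⟨ identityʳ _ ⟩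
          E.from r                                  ∎)) (E.strictlyInverseˡ r) , x′≈x
          where
          open ≈-Reasoning G.setoid
          x′ = point (Q.to x) (E.to (E.from r ∙ h x))
          x′≈x : x′ ≈ x
          x′≈x = X.trans (·-cong (E.strictlyInverseʳ _) X.refl) (∙-· (h-rep x) fixed)

        pairs : Inverse Pairs′ (setoid (Fin N) ×ₛ setoid (Fin K))
        pairs = mkInverse _ _ to from
          (λ { {(r , x) , _} (refl , e) → Q.to-cong (≈⇒~ e) , E.to-cong (∙-congˡ (h-cong e)) })
          (λ { (refl , refl) → refl , X.refl }) to∘from from∘to

        -- Double counting: grouped by group element, the same pairs give the sum of the fixed-point
        -- counts.
        orbits*order : N * K ≡ ∑Fin K k
        orbits*order = size-unique (Inv.trans pairs (size-× (Inv.refl _) (Inv.refl _)))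
                                   (size-Σ X K k Fix-size)

-- Strings over a subset of the letters

sum-applyUpTo-* : ∀ k (f : ℕ → ℕ) m →
                  sum (applyUpTo (λ i → k * f i) m) ≡ k * sum (applyUpTo f m)
sum-applyUpTo-* k f zero    = sym (*-zeroʳ k)
sum-applyUpTo-* k f (suc m) =
  trans (cong (_+_ (k * f 0)) (sum-applyUpTo-* k (f ∘ suc) m)) (sym (*-distribˡ-+ k (f 0) _))

-- The recursion behind `size-words`: a nonempty string of length at most m + 1 is one of k letters,
-- followed either by nothing or by a nonempty string of length at most m.
∑-powers-suc : ∀ k m → k * (1 + ∑[1≤k≤ m ] (k ^_)) ≡ ∑[1≤k≤ suc m ] (k ^_)
∑-powers-suc k m =
  trans (*-distribˡ-+ k 1 _) (cong (_+_ (k * 1)) (sym (sum-applyUpTo-* k (λ i → k ^ suc i) m)))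

module _ {D : Set a} (P : D → Set p) where

  Words : ℕ → Setoid _ _
  Words m = setoid (List⁺ D) ∣ₛ (λ w → List⁺.length w ≤ m × All P (toList w))

  size-words : ∀ {k} → (setoid D ∣ₛ P) HasSize k → ∀ m → Words m HasSize ∑[1≤k≤ m ] (k ^_)
  size-words s zero = mkInverse (Words 0) (setoid (Fin 0))
    (λ { (_ , () , _) }) (λ ()) (λ { {_ , () , _} }) (λ { {()} }) (λ ()) (λ { (_ , () , _) })
  size-words {k} s (suc m) = subst (Words (suc m) HasSize_) (∑-powers-suc k m)
    (Inv.trans uncons (size-× s (size-⊎ ⊤-size (size-words s m))))
    where
    ⊤-size : setoid ⊤ HasSize 1
    ⊤-size = mkInverse (setoid ⊤) (setoid (Fin 1)) (λ _ → zero) (λ _ → tt)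
      (λ _ → refl) (λ _ → refl) (λ { zero → refl }) (λ _ → refl)
    Target : Setoid _ _
    Target = (setoid D ∣ₛ P) ×ₛ (setoid ⊤ ⊎ₛ Words m)
    to : Carrier (Words (suc m)) → Carrier Target
    to ((x ∷ [])     , _ , px ∷ _)    = (x , px) , inj₁ tt
    to ((x ∷ y ∷ ys) , s≤s l , px ∷ ps) = (x , px) , inj₂ (y ∷ ys , l , ps)
    from : Carrier Target → Carrier (Words (suc m))
    from ((x , px) , inj₁ _)                  = (x ∷ []) , s≤s z≤n , px ∷ []
    from ((x , px) , inj₂ (y ∷ ys , l , ps)) = (x ∷ y ∷ ys) , s≤s l , px ∷ ps
    uncons : Inverse (Words (suc m)) Target
    uncons = mkInverse _ _ to from
      (λ { {(_ ∷ []) , _ , _ ∷ _} {._ , _ , _ ∷ _} refl → refl , inj₁ refl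
         ; {(_ ∷ _ ∷ _) , s≤s _ , _ ∷ _} {._ , s≤s _ , _ ∷ _} refl → refl , inj₂ refl })
      (λ { {_ , inj₁ _} (refl , inj₁ refl) → refl
         ; {_ , inj₂ (_ ∷ _ , _ , _)} {_ , inj₂ (_ ∷ _ , _ , _)} (refl , inj₂ refl) → refl })
      (λ { (_ , inj₁ _) → refl , inj₁ refl
         ; (_ , inj₂ (_ ∷ _ , _ , _)) → refl , inj₂ refl })
      (λ { ((_ ∷ []) , _ , _ ∷ _) → refl
         ; ((_ ∷ _ ∷ _) , s≤s _ , _ ∷ _) → refl })

-- Lists without repetitions

lookup-injective : ∀ {xs : List A} → Unique xs → ∀ i j → lookup xs i ≡ lookup xs j → i ≡ j
lookup-injective (_ ∷ _)  zero    zero    _ = refl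
lookup-injective (x∉ ∷ _) zero    (suc j) e = contradiction e (All.lookup x∉ (∈-lookup j))
lookup-injective (x∉ ∷ _) (suc i) zero    e = contradiction (sym e) (All.lookup x∉ (∈-lookup i))
lookup-injective (_ ∷ u)  (suc i) (suc j) e = cong suc (lookup-injective u i j e)

Unique-++⁻ : ∀ (xs : List A) {ys} → Unique (xs ++ ys) →
             Unique xs × Unique ys × (∀ {x} → x ∈ xs → x ∉ ys)
Unique-++⁻ []       u        = [] , u , λ ()
Unique-++⁻ (x ∷ xs) (x∉ ∷ u) =
  let uxs , uys , disj = Unique-++⁻ xs u
  in  All.++⁻ˡ xs x∉ ∷ uxs , uys ,
      λ { (here refl) x∈ys → All.lookup (All.++⁻ʳ xs x∉) x∈ys refl
        ; (there x∈xs)     → disj x∈xs }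

module _ (f : A → List B) where

  Unique-concatMap⁻ : ∀ xs → Unique (List.concatMap f xs) → ∀ {x} → x ∈ xs → Unique (f x)
  Unique-concatMap⁻ (x ∷ xs) u (here refl) = proj₁ (Unique-++⁻ (f x) u)
  Unique-concatMap⁻ (x ∷ xs) u (there x∈)  =
    Unique-concatMap⁻ xs (proj₁ (proj₂ (Unique-++⁻ (f x) u))) x∈

  -- For the list of cycles this says that a letter determines the cycle through it.
  concatMap-index-unique : ∀ xs → Unique (List.concatMap f xs) → ∀ {y} i j →
    y ∈ f (lookup xs i) → y ∈ f (lookup xs j) → i ≡ j
  concatMap-index-unique (x ∷ xs) u zero    zero    _ _ = refl
  concatMap-index-unique (x ∷ xs) u zero    (suc j) y∈ y∈′ =
    contradiction (∈-concatMap⁺ f (Any.map (λ { refl → y∈′ }) (∈-lookup {xs = xs} j)))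
                  (proj₂ (proj₂ (Unique-++⁻ (f x) u)) y∈)
  concatMap-index-unique (x ∷ xs) u (suc i) zero    y∈ y∈′ =
    contradiction (∈-concatMap⁺ f (Any.map (λ { refl → y∈ }) (∈-lookup {xs = xs} i)))
                  (proj₂ (proj₂ (Unique-++⁻ (f x) u)) y∈′)
  concatMap-index-unique (x ∷ xs) u (suc i) (suc j) y∈ y∈′ =
    cong suc (concatMap-index-unique xs (proj₁ (proj₂ (Unique-++⁻ (f x) u))) i j y∈ y∈′)

-- The number of an element is its position as read off a proof of membership; the absence of
-- repetitions makes it independent of that proof.
size-list : ∀ {P : A → Set p} {xs} → Unique xs → (∀ x → x ∈ xs → P x) → (∀ x → P x → x ∈ xs) →
            (setoid A ∣ₛ P) HasSize length xs
size-list {A = A} {P = P} {xs} u sound complete = mkInverse (setoid A ∣ₛ P) (setoid (Fin (length xs)))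
  to from to-cong (cong (lookup xs))
  (λ i → lookup-injective u _ i (sym (lookup-index (complete _ (proj₂ (from i))))))
  (λ (x , px) → sym (lookup-index (complete x px)))
  where
  to : Carrier (setoid A ∣ₛ P) → Fin (length xs)
  to (x , px) = index (complete x px)
  from : Fin (length xs) → Carrier (setoid A ∣ₛ P)
  from i = lookup xs i , sound _ (∈-lookup i)
  to-cong : ∀ {s t : Carrier (setoid A ∣ₛ P)} → proj₁ s ≡ proj₁ t → to s ≡ to t
  to-cong {x , px} {y , py} e = lookup-injective u _ _
    (trans (sym (lookup-index (complete x px))) (trans e (lookup-index (complete y py))))

-- Cycles of a permutation

fold-suc : ∀ (s : A → A) z n → fold (s z) s n ≡ s (fold z s n)
fold-suc s z zero    = refl
fold-suc s z (suc n) = cong s (fold-suc s z n)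

module _ (S : Setoid a ℓ) (γ : Carrier S → Carrier S)
         (γ-cong : ∀ {s t} → Setoid._≈_ S s t → Setoid._≈_ S (γ s) (γ t)) where
  open Setoid S using (_≈_) renaming (refl to ≈-refl; trans to ≈-trans; reflexive to ≈-reflexive)

  fold-cong : ∀ i {s t} → s ≈ t → fold s γ i ≈ fold t γ i
  fold-cong zero    e = e
  fold-cong (suc i) e = γ-cong (fold-cong i e)

  fold-periodic : ∀ {k s} → fold s γ k ≈ s → ∀ {n} → k ∣ n → fold s γ n ≈ s
  fold-periodic {k} {s} e (divides q refl) = go q
    where
    go : ∀ q → fold s γ (q * k) ≈ s
    go zero    = ≈-refl
    go (suc q) = ≈-trans (≈-reflexive (fold-+ s γ k)) (≈-trans (fold-cong k (go q)) e)

fold-injective : ∀ (f : A → A) → (∀ {x y} → f x ≡ f y → x ≡ y) →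
                 ∀ i {x y} → fold x f i ≡ fold y f i → x ≡ y
fold-injective f inj zero    e = e
fold-injective f inj (suc i) e = fold-injective f inj i (inj e)

∈-iterate⁺ : ∀ (f : A → A) x {i n} → i < n → fold x f i ∈ List.iterate f x n
∈-iterate⁺ f x {zero}  (s≤s _)   = here refl
∈-iterate⁺ f x {suc i} (s≤s i<n) =
  there (subst (_∈ _) (fold-suc f x i) (∈-iterate⁺ f (f x) i<n))

∈-iterate⁻ : ∀ (f : A → A) {x y} n → y ∈ List.iterate f x n → ∃[ i ] fold x f i ≡ y
∈-iterate⁻ f (suc n) (here refl) = 0 , refl
∈-iterate⁻ f {x} (suc n) (there y∈) =
  let i , e = ∈-iterate⁻ f n y∈ in suc i , trans (sym (fold-suc f x i)) e

module _ {D : Set a} (g : D ↔ D) where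
  open Inverse g using (to; strictlyInverseʳ)

  to-injective : ∀ {x y} → to x ≡ to y → x ≡ y
  to-injective {x} {y} e =
    trans (sym (strictlyInverseʳ x)) (trans (cong (Inverse.from g) e) (strictlyInverseʳ y))

  _⟨_⟩ : D → ℕ → D
  d ⟨ i ⟩ = fold d to i

  -- A cycle is the case where `y` is the head `x`. Separating the two lets the equation pass to the
  -- tail, where the first letter changes and `y` stays.
  map≡rotate : ∀ x xs y → List.map to (x ∷ xs) ≡ xs List.∷ʳ y →
               x ∷ xs ≡ List.iterate to x (suc (length xs)) × x ⟨ suc (length xs) ⟩ ≡ y
  map≡rotate x []        y e = refl , ∷-injectiveˡ e
  map≡rotate x (x′ ∷ xs) y e with ∷-injective e
  ... | refl , es with map≡rotate x′ xs y es
  ...   | xs≡ , end = cong (x ∷_) xs≡ , trans (cong to (sym (fold-suc to x (length xs)))) end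

  toList-∷ʳ : ∀ (xs : List D) y → toList (xs List⁺.∷ʳ y) ≡ xs List.∷ʳ y
  toList-∷ʳ []       y = refl
  toList-∷ʳ (x ∷ xs) y = refl

  module _ {c : List⁺ D} (cycle : IsCycle g c) where
    private
      orbit : toList c ≡ List.iterate to (head c) (List⁺.length c) × head c ⟨ List⁺.length c ⟩ ≡ head c
      orbit = map≡rotate (head c) (tail c) (head c)
        (trans (cong toList cycle) (toList-∷ʳ (tail c) (head c)))

    cycle-period : head c ⟨ List⁺.length c ⟩ ≡ head c
    cycle-period = proj₂ orbit

    cycle-power : ∀ {d} → d ∈ toList c → ∃[ i ] head c ⟨ i ⟩ ≡ d
    cycle-power {d} d∈ = ∈-iterate⁻ to (List⁺.length c) (subst (d ∈_) (proj₁ orbit) d∈)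

    private
      power-% : ∀ i → head c ⟨ i ⟩ ≡ head c ⟨ i % List⁺.length c ⟩
      power-% i = begin
        head c ⟨ i ⟩                  ≡⟨ cong (head c ⟨_⟩) (m≡m%n+[m/n]*n i n) ⟩
        head c ⟨ i % n + i / n * n ⟩  ≡⟨ fold-+ (head c) to (i % n) ⟩
        head c ⟨ i / n * n ⟩ ⟨ i % n ⟩ ≡⟨ cong (_⟨ i % n ⟩)
          (fold-periodic (setoid D) to (cong to) cycle-period (divides (i / n) refl)) ⟩
        head c ⟨ i % n ⟩              ∎
        where
        open ≡-Reasoning
        n = List⁺.length c

    power-∈ : ∀ i → head c ⟨ i ⟩ ∈ toList c
    power-∈ i = subst (head c ⟨ i ⟩ ∈_) (sym (proj₁ orbit))
      (subst (_∈ _) (sym (power-% i)) (∈-iterate⁺ to (head c) (m%n<n i (List⁺.length c))))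

    -- If `i` left a nonzero remainder modulo the length, that many steps would already return to
    -- the head, which would then occur a second time in the cycle.
    period-∣ : Unique (toList c) → ∀ i → head c ⟨ i ⟩ ≡ head c → List⁺.length c ∣ i
    period-∣ u i e with i % List⁺.length c in r≡ | m%n<n i (List⁺.length c)
                        | trans (sym (power-% i)) e
    ... | zero  | _       | _  = m%n≡0⇒n∣m i (List⁺.length c) r≡
    ... | suc r | s≤s r<n | e′ with subst Unique (proj₁ orbit) u
    ...   | h∉ ∷ _ = contradiction (sym e′)
      (All.lookup h∉ (subst (_∈ _) (fold-suc to (head c) r) (∈-iterate⁺ to (to (head c)) r<n)))

    -- The letter is the head moved by some power of `g`. Powers of `g` commute and are injective,
    -- so the k-th power fixes the letter iff it fixes the head.
    fixed⇔∣ : Unique (toList c) → ∀ {d} → d ∈ toList c → ∀ k →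
              (d ⟨ k ⟩ ≡ d → List⁺.length c ∣ k) × (List⁺.length c ∣ k → d ⟨ k ⟩ ≡ d)
    fixed⇔∣ u d∈ k with cycle-power d∈
    ... | i , refl = (λ e → period-∣ u k (fold-injective to to-injective i (trans (sym comm) e))) ,
                     (λ n∣k → trans comm (cong (_⟨ i ⟩)
                       (fold-periodic (setoid D) to (cong to) cycle-period n∣k)))
      where
      h = head c
      comm : h ⟨ i ⟩ ⟨ k ⟩ ≡ h ⟨ k ⟩ ⟨ i ⟩
      comm = trans (sym (fold-+ h to k)) (trans (cong (h ⟨_⟩) (+-comm k i)) (fold-+ h to i))

-- Maps commuting with a permutation, cycle by cycle

module _ {D : Set a} {g : D ↔ D} (Δ : CycleDecomposition g) where
  open CycleDecomposition Δ using (cycles; areCycle; disjoint; covering)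
  open Inverse g using (to)

  cycleAt : Fin (length cycles) → List⁺ D
  cycleAt = lookup cycles

  headAt : Fin (length cycles) → D
  headAt = head ∘ cycleAt

  lengthAt : Fin (length cycles) → ℕ
  lengthAt = List⁺.length ∘ cycleAt

  private
    isCycleAt : ∀ j → IsCycle g (cycleAt j)
    isCycleAt j = areCycle (∈-lookup j)

    uniqueAt : ∀ j → Unique (toList (cycleAt j))
    uniqueAt j = Unique-concatMap⁻ toList cycles disjoint (∈-lookup j)

  locate : ∀ d → ∃[ j ] ∃[ i ] fold (headAt j) to i ≡ d
  locate d =
    let d∈ = ∈-concatMap⁻ toList {xs = cycles} (covering d)
    in  index d∈ , cycle-power g (isCycleAt (index d∈)) (lookup-index d∈)

  module _ (S : Setoid b ℓ) (γ : Carrier S → Carrier S)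
           (γ-cong : ∀ {s t} → Setoid._≈_ S s t → Setoid._≈_ S (γ s) (γ t)) where
    private module S = Setoid S
    open S using (_≈_)

    Equivariant : Setoid _ _
    Equivariant = (D ⇒ₛ S) ∣ₛ (λ f → ∀ d → f (to d) ≈ γ (f d))

    Periodic : Setoid _ _
    Periodic = Choices S (length cycles) (λ j s → fold s γ (lengthAt j) ≈ s)

    module _ (T : Carrier Periodic) where

      private
        t = proj₁ T
        periodic = proj₂ T

        -- Cancelling `i` steps shows that `i′ ∸ i` steps return to the head. The cycle length
        -- therefore divides `i′ ∸ i`, and the periodicity of `t j` absorbs the surplus.
        shift : ∀ j {i i′} → i ≤ i′ → fold (headAt j) to i ≡ fold (headAt j) to i′ →
                fold (t j) γ i′ ≈ fold (t j) γ i
        shift j {i} {i′} i≤i′ e = subst (λ n → fold (t j) γ n ≈ fold (t j) γ i) (m+[n∸m]≡n i≤i′)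
          (S.trans (S.reflexive (fold-+ (t j) γ i)) (fold-cong S γ γ-cong i
            (fold-periodic S γ γ-cong (periodic j)
              (period-∣ g (isCycleAt j) (uniqueAt j) (i′ ∸ i) returns))))
          where
          h = headAt j
          returns : fold h to (i′ ∸ i) ≡ h
          returns = fold-injective to (to-injective g) i (begin
            fold (fold h to (i′ ∸ i)) to i  ≡⟨ fold-+ h to i ⟨
            fold h to (i + (i′ ∸ i))        ≡⟨ cong (fold h to) (m+[n∸m]≡n i≤i′) ⟩
            fold h to i′                    ≡⟨ e ⟨
            fold h to i                     ∎)
            where open ≡-Reasoning

      -- Hence transporting t j along its cycle does not depend on the number of steps chosen.
      coherent : ∀ j i j′ i′ → fold (headAt j) to i ≡ fold (headAt j′) to i′ →
                 fold (t j) γ i ≈ fold (t j′) γ i′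
      coherent j i j′ i′ e
        with concatMap-index-unique toList cycles disjoint j j′
               (power-∈ g (isCycleAt j) i)
               (subst (_∈ toList (cycleAt j′)) (sym e) (power-∈ g (isCycleAt j′) i′))
           | ≤-total i i′
      ... | refl | inj₁ i≤i′ = S.sym (shift j i≤i′ e)
      ... | refl | inj₂ i′≤i = shift j i′≤i (sym e)

      transport : D → Carrier S
      transport d = let j , i , _ = locate d in fold (t j) γ i

      transport-power : ∀ j i → transport (fold (headAt j) to i) ≈ fold (t j) γ i
      transport-power j i = let j′ , i′ , e = locate (fold (headAt j) to i) in coherent j′ i′ j i e

      transport-equivariant : ∀ d → transport (to d) ≈ γ (transport d)
      transport-equivariant d =
        let j , i , e = locate d
        -- If `d` lies `i` steps after a head, then `to d` lies `suc i` steps after the same head.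
        in  S.trans (S.reflexive (cong transport (cong to (sym e)))) (transport-power j (suc i))

    -- By `powers`, i steps before applying f amount to i applications of `γ` afterwards. With i the
    -- length of a cycle this makes the value at the head periodic; with i arbitrary it recovers f
    -- from its values at the heads.
    equivariant↔periodic : Inverse Equivariant Periodic
    equivariant↔periodic = mkInverse Equivariant Periodic
      (λ (f , e) → f ∘ headAt , λ j →
        S.trans (S.sym (powers f e (headAt j) (lengthAt j)))
                (S.reflexive (cong f (cycle-period g (isCycleAt j)))))
      (λ t → transport t , transport-equivariant t)
      (λ e j → e (headAt j))
      (λ e d → let j , i , _ = locate d in fold-cong S γ γ-cong i (e j))
      (λ t j → transport-power t j 0)
      (λ (f , e) d → let j , i , e′ = locate d in
        S.trans (S.sym (powers f e (headAt j) i)) (S.reflexive (cong f e′)))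
      where
      powers : ∀ f → (∀ d → f (to d) ≈ γ (f d)) → ∀ d i → f (fold d to i) ≈ fold (f d) γ i
      powers f e d zero    = S.refl
      powers f e d (suc i) = S.trans (e _) (γ-cong (powers f e d i))

-- Counting the letters fixed by a power of the permutation

module _ (f f′ : ℕ → ℕ) {l k} (at : f l ≡ k + f′ l) (off : ∀ {j} → j ≢ l → f j ≡ f′ j) where

  sum-map-off : ∀ js → l ∉ js → sum (List.map f js) ≡ sum (List.map f′ js)
  sum-map-off js l∉ =
    cong sum (map-cong-local {xs = js} (All.tabulate (λ {j} j∈ → off (λ { refl → l∉ j∈ }))))

  -- Serves to add one cycle of length `l` to a list of cycles: among the terms j c(j) only the one
  -- at `l` changes, and it grows by `l`. Uniqueness ensures that this term is counted once.
  sum-map-at : ∀ {js} → Unique js → l ∈ js → sum (List.map f js) ≡ k + sum (List.map f′ js)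
  sum-map-at {js = _ ∷ js} (l∉ ∷ _) (here refl) =
    trans (cong₂ _+_ at (sum-map-off js (λ l∈ → All.lookup l∉ l∈ refl))) (+-assoc k _ _)
  sum-map-at {js = j ∷ js} (j∉ ∷ u) (there l∈) = begin
    f j + sum (List.map f js)         ≡⟨ cong₂ _+_ (off (All.lookup j∉ l∈)) (sum-map-at u l∈) ⟩
    f′ j + (k + sum (List.map f′ js)) ≡⟨ +-assoc (f′ j) k _ ⟨
    f′ j + k + sum (List.map f′ js)   ≡⟨ cong (_+ sum (List.map f′ js)) (+-comm (f′ j) k) ⟩
    k + f′ j + sum (List.map f′ js)   ≡⟨ +-assoc k (f′ j) _ ⟩
    k + (f′ j + sum (List.map f′ js)) ∎
    where open ≡-Reasoning

module _ (k : ℕ) where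

  divisors-unique : Unique (divisors k)
  divisors-unique = Unique.filter⁺ (_∣? k)
    (Unique.applyUpTo⁺₁ suc k (λ i<j _ e → <⇒≢ i<j (suc-injective e)))

  -- Divisors are sought among 1, ..., k, which contains them all only for nonzero `k`, since
  -- everything divides 0.
  ∈-divisors⁺ : .{{NonZero k}} → ∀ {j} → suc j ∣ k → suc j ∈ divisors k
  ∈-divisors⁺ j∣k = ∈-filter⁺ (_∣? k) (∈-applyUpTo⁺ suc (∣⇒≤ j∣k)) j∣k

  ∈-divisors⁻ : ∀ {j} → j ∈ divisors k → j ∣ k
  ∈-divisors⁻ j∈ = proj₂ (∈-filter⁻ (_∣? k) {xs = applyUpTo suc k} j∈)

module _ {D : Set a} (_≟_ : DecidableEquality D) {g : D ↔ D} (Δ : CycleDecomposition g) where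
  open CycleDecomposition Δ using (cycles; areCycle; disjoint; covering)
  open Inverse g using (to)

  module _ (k : ℕ) .{{_ : NonZero k}} where

    private
      Fixed? : Decidable (λ d → fold d to k ≡ d)
      Fixed? d = fold d to k ≟ d

      count′ : List (List⁺ D) → ℕ → ℕ
      count′ cs j = length (filter (λ c → List⁺.length c ≟ᴺ j) cs)

    -- A cycle of length n contributes all of its n letters if n divides `k`, and none otherwise. An
    -- arbitrary list of cycles, not necessarily covering D, allows induction cycle by cycle.
    length-fixed : ∀ cs → All (λ c → IsCycle g c × Unique (toList c)) cs →
      length (filter Fixed? (List.concatMap toList cs)) ≡ ∑∣ k (λ j → j * count′ cs j)
    length-fixed []       []                = sym (zeros (divisors k))
      where
      zeros : ∀ js → sum (List.map (_* 0) js) ≡ 0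
      zeros []       = refl
      zeros (j ∷ js) = cong₂ _+_ (*-zeroʳ j) (zeros js)
    length-fixed (c ∷ cs) ((cyc , u) ∷ all) = begin
      length (filter Fixed? (toList c ++ List.concatMap toList cs))
        ≡⟨ cong length (filter-++ Fixed? (toList c) _) ⟩
      length (filter Fixed? (toList c) ++ filter Fixed? (List.concatMap toList cs))
        ≡⟨ length-++ (filter Fixed? (toList c)) ⟩
      length (filter Fixed? (toList c)) + length (filter Fixed? (List.concatMap toList cs))
        ≡⟨ cong (_+_ (length (filter Fixed? (toList c)))) (length-fixed cs all) ⟩
      length (filter Fixed? (toList c)) + ∑∣ k (λ j → j * count′ cs j)
        ≡⟨ contribution (List⁺.length c ∣? k) ⟩
      ∑∣ k (λ j → j * count′ (c ∷ cs) j) ∎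
      where
      open ≡-Reasoning
      n = List⁺.length c

      at : n * count′ (c ∷ cs) n ≡ n + n * count′ cs n
      at = trans (cong (λ l → n * length l) (filter-accept (λ c → List⁺.length c ≟ᴺ n) {c} {cs} refl))
                 (*-suc n (count′ cs n))

      off : ∀ {j} → j ≢ n → j * count′ (c ∷ cs) j ≡ j * count′ cs j
      off {j} j≢n = cong (λ l → j * length l)
        (filter-reject (λ c → List⁺.length c ≟ᴺ j) {c} {cs} (j≢n ∘ sym))

      contribution : Dec (n ∣ k) → length (filter Fixed? (toList c)) + ∑∣ k (λ j → j * count′ cs j)
                                   ≡ ∑∣ k (λ j → j * count′ (c ∷ cs) j)
      contribution (yes n∣k) = trans
        (cong (_+ _) (cong length (filter-all Fixed?
          (All.tabulate (λ d∈ → proj₂ (fixed⇔∣ g cyc u d∈ k) n∣k)))))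
        (sym (sum-map-at _ _ {k = n} at off (divisors-unique k) (∈-divisors⁺ k n∣k)))
      contribution (no n∤k) = trans
        (cong (_+ _) (cong length (filter-none Fixed?
          (All.tabulate (λ d∈ → n∤k ∘ proj₁ (fixed⇔∣ g cyc u d∈ k))))))
        (sym (sum-map-off _ _ {k = n} at off (divisors k) (n∤k ∘ ∈-divisors⁻ k)))

    size-fixed : (setoid D ∣ₛ (λ d → fold d to k ≡ d)) HasSize ∑∣ k (λ j → j * count Δ j)
    size-fixed = subst ((setoid D ∣ₛ (λ d → fold d to k ≡ d)) HasSize_)
      (length-fixed cycles (All.tabulate (λ c∈ → areCycle c∈ , Unique-concatMap⁻ toList cycles disjoint c∈)))
      (size-list (Unique.filter⁺ Fixed? disjoint)
        (λ d d∈ → proj₂ (∈-filter⁻ Fixed? {xs = List.concatMap toList cycles} d∈))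
        (λ d fixed → ∈-filter⁺ Fixed? (covering d) fixed))

-- The action of Sym(D) on m-endomorphisms

open Inverse using (to; from; strictlyInverseˡ; strictlyInverseʳ)

SymGroup : Set a → Group a a
SymGroup D = record
  { Carrier = D ↔ D
  ; _≈_ = Setoid._≈_ (Sym D)
  ; _∙_ = _↔-∘_
  ; ε   = ↔-id D
  ; _⁻¹ = ↔-sym
  ; isGroup = record
    { isMonoid = record
      { isSemigroup = record
        { isMagma = record
          { isEquivalence = Setoid.isEquivalence (Sym D)
          ; ∙-cong = λ {g} p q d → trans (cong (to g) (q d)) (p _)
          }
        ; assoc = λ _ _ _ _ → refl
        }
      ; identity = (λ _ _ → refl) , (λ _ _ → refl)
      }
    ; inverse = strictlyInverseʳ , strictlyInverseˡ
    ; ⁻¹-cong = λ {g} {h} → from-≗ g h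
    }
  }
  where
  -- Equality in `Sym` compares only the forward maps, so the agreement of the inverses has to be
  -- derived.
  from-≗ : ∀ (g h : D ↔ D) → to g ≗ to h → from g ≗ from h
  from-≗ g h p d = begin
    from g d                    ≡⟨ strictlyInverseʳ h _ ⟨
    from h (to h (from g d))    ≡⟨ cong (from h) (p _) ⟨
    from h (to g (from g d))    ≡⟨ cong (from h) (strictlyInverseˡ g d) ⟩
    from h d                    ∎
    where open ≡-Reasoning

Strings : ℕ → Set a → Setoid a a
Strings m D = setoid (List⁺ D) ∣ₛ (λ w → List⁺.length w ≤ m)

relabel : ∀ {m} → (D → D) → Carrier (Strings m D) → Carrier (Strings m D)
relabel f (w , l) = List⁺.map f w , ≤-trans (≤-reflexive (length-map f w)) l

map-fixed⁻ : ∀ {f : A → A} xs → List.map f xs ≡ xs → All (λ x → f x ≡ x) xs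
map-fixed⁻ []       e = []
map-fixed⁻ (x ∷ xs) e = let e₁ , e₂ = ∷-injective e in e₁ ∷ map-fixed⁻ xs e₂

map-fixed⁺ : ∀ {f : A → A} xs → All (λ x → f x ≡ x) xs → List.map f xs ≡ xs
map-fixed⁺ []       []       = refl
map-fixed⁺ (x ∷ xs) (e ∷ es) = cong₂ _∷_ e (map-fixed⁺ xs es)

module _ {D : Set a} {m : ℕ} where

  fold-relabel : ∀ (f : D → D) (s : Carrier (Strings m D)) k →
    proj₁ (fold s (relabel f) k) ≡ List⁺.map (λ d → fold d f k) (proj₁ s)
  fold-relabel f (w , l) zero    = sym (map-id w)
  fold-relabel f s       (suc k) =
    trans (cong (List⁺.map f) (fold-relabel f s k)) (sym (map⁺-∘ (proj₁ s)))

  periodic↔words : ∀ (f : D → D) k →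
    Inverse (Strings m D ∣ₛ (λ s → proj₁ (fold s (relabel f) k) ≡ proj₁ s))
            (Words (λ d → fold d f k ≡ d) m)
  periodic↔words f k = mkInverse _ _
    (λ ((w , l) , e) → w , l , map-fixed⁻ _ (cong toList (trans (sym (fold-relabel f (w , l) k)) e)))
    (λ (w , l , fixed) → (w , l) ,
      trans (fold-relabel f (w , l) k) (toList-injective (map-fixed⁺ _ fixed)))
    id id (λ _ → refl) (λ _ → refl)
    where
    toList-injective : ∀ {v w : List⁺ D} → toList v ≡ toList w → v ≡ w
    toList-injective refl = refl

-- Endomorphisms and their values on letters

homomorphism-ext : {h h′ : List⁺ A → List⁺ B} →
  (∀ U V → h (U ⁺++⁺ V) ≡ h U ⁺++⁺ h V) → (∀ U V → h′ (U ⁺++⁺ V) ≡ h′ U ⁺++⁺ h′ V) →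
  (∀ d → h [ d ] ≡ h′ [ d ]) → h ≗ h′
homomorphism-ext {h = h} {h′ = h′} homo homo′ letters (x ∷ xs) = go x xs
  where
  go : ∀ x xs → h (x ∷ xs) ≡ h′ (x ∷ xs)
  go x []       = letters x
  go x (y ∷ ys) = trans (homo [ x ] (y ∷ ys))
    (trans (cong₂ _⁺++⁺_ (letters x) (go y ys)) (sym (homo′ [ x ] (y ∷ ys))))

⁺++-identityʳ : (W : List⁺ A) → W ⁺++ [] ≡ W
⁺++-identityʳ (x ∷ xs) = cong (x ∷_) (++-identityʳ xs)

extend-homo : ∀ (f : A → List⁺ A) U V → extend f (U ⁺++⁺ V) ≡ extend f U ⁺++⁺ extend f V
extend-homo f (x ∷ xs) V = go x xs
  where
  go : ∀ x xs → extend f ((x ∷ xs) ⁺++⁺ V) ≡ extend f (x ∷ xs) ⁺++⁺ extend f V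
  go x []       = cong (_⁺++⁺ extend f V) (sym (⁺++-identityʳ (f x)))
  go x (y ∷ ys) = trans (cong (λ W → f x ⁺++ toList W) (go y ys))
    (cong (head (f x) ∷_) (sym (++-assoc (tail (f x)) _ _)))

module _ (m : ℕ) (D : Set a) where

  private
    S = Strings m D
    X = D ⇒ₛ S

    _·_ : D ↔ D → Carrier X → Carrier X
    (g · f) d = relabel (to g) (f (from g d))

  open Burnside (SymGroup D) X _·_
    (λ {g} {h} {f} {f′} g≈h f≈f′ d → trans (map-cong g≈h _)
      (cong (List⁺.map (to h)) (trans (f≈f′ (from g d))
        (cong (proj₁ ∘ f′) (Group.⁻¹-cong (SymGroup D) {g} {h} g≈h d)))))
    (λ f d → map-id _)
    (λ g h f d → map⁺-∘ _)
    using (Fix; Orbits; burnside) public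

  -- The same bijection `g` witnesses both equivalences. Evaluated at the letter `from g d`, the
  -- intertwining relation says that `g` carries one letter map to the other; conversely, both sides
  -- of that relation are homomorphisms and need only agree on letters.
  endomorphismClasses↔orbits : Inverse (EndomorphismClasses m D) Orbits
  endomorphismClasses↔orbits = mkInverse _ _ letters extension
    (λ {φ} {ψ} (g , e) → g , λ d → begin
      List⁺.map (to g) (⟦ φ ⟧ [ from g d ])  ≡⟨ letterwise≗map g _ ⟨
      letterwise g (⟦ φ ⟧ [ from g d ])      ≡⟨ e [ from g d ] ⟨
      ⟦ ψ ⟧ [ to g (from g d) ]              ≡⟨ cong (λ x → ⟦ ψ ⟧ [ x ]) (strictlyInverseˡ g d) ⟩
      ⟦ ψ ⟧ [ d ]                            ∎)
    (λ {f} {f′} (g , e) → g , intertwines g (extension f) (extension f′) (λ d → begin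
      extend (proj₁ ∘ f′) [ to g d ]                ≡⟨ ⁺++-identityʳ _ ⟩
      proj₁ (f′ (to g d))                           ≡⟨ e (to g d) ⟨
      List⁺.map (to g) (proj₁ (f (from g (to g d))))
        ≡⟨ cong (λ x → List⁺.map (to g) (proj₁ (f x))) (strictlyInverseʳ g d) ⟩
      List⁺.map (to g) (proj₁ (f d))                ≡⟨ cong (List⁺.map (to g)) (⁺++-identityʳ _) ⟨
      List⁺.map (to g) (extend (proj₁ ∘ f) [ d ])   ∎))
    (λ f → ↔-id D , λ d → trans (map-id _) (⁺++-identityʳ _))
    (λ φ → ↔-id D , intertwines (↔-id D) (extension (letters φ)) φ
      (λ d → sym (trans (map-id _) (⁺++-identityʳ _))))
    where
    open ≡-Reasoning
    letters : MEndomorphism m D → Carrier X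
    letters φ d = ⟦ φ ⟧ [ d ] , bounded φ d

    extension : Carrier X → MEndomorphism m D
    extension f = record
      { ⟦_⟧     = extend (proj₁ ∘ f)
      ; homo    = extend-homo (proj₁ ∘ f)
      ; bounded = λ d → ≤-trans (≤-reflexive (cong List⁺.length (⁺++-identityʳ (proj₁ (f d)))))
                                (proj₂ (f d))
      }

    intertwines : ∀ g (φ ψ : MEndomorphism m D) →
      (∀ d → ⟦ ψ ⟧ [ to g d ] ≡ List⁺.map (to g) (⟦ φ ⟧ [ d ])) →
      ⟦ ψ ⟧ ∘ letterwise g ≗ letterwise g ∘ ⟦ φ ⟧
    intertwines g φ ψ e W =
      trans (cong ⟦ ψ ⟧ (letterwise≗map g W)) (trans
        (homomorphism-ext {h = ⟦ ψ ⟧ ∘ List⁺.map (to g)} {h′ = List⁺.map (to g) ∘ ⟦ φ ⟧}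
          (λ U V → trans (cong ⟦ ψ ⟧ (map-⁺++⁺ (to g) U V)) (homo ψ _ _))
          (λ U V → trans (cong (List⁺.map (to g)) (homo φ U V)) (map-⁺++⁺ (to g) _ _))
          e W)
        (sym (letterwise≗map g _)))

  size-Fix : ∀ {n} → D ↔ Fin n → ∀ {g : D ↔ D} (Δ : CycleDecomposition g) →
    Fix g HasSize ∏∈ (cycleType Δ) (λ k → ∑[1≤k≤ m ] (λ e → (∑∣ k (λ j → j * count Δ j)) ^ e))
  size-Fix D↔Fin {g} Δ = subst (Fix g HasSize_) eq
    -- Being fixed under conjugation is rewritten as commuting with `g`, which removes the inverse
    -- and gives the form of `Equivariant`.
    (Inv.trans (subset-⇔ X
       (λ f e d → trans (sym (e (to g d)))
         (cong (λ x → List⁺.map (to g) (proj₁ (f x))) (strictlyInverseʳ g d)))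
       (λ f e d → trans (sym (e (from g d))) (cong (proj₁ ∘ f) (strictlyInverseˡ g d))))
    (Inv.trans (equivariant↔periodic Δ S (relabel (to g)) (cong (List⁺.map (to g))))
      (size-Π S (length cycles) _ (λ j →
        Inv.trans (periodic↔words (to g) (lengthAt Δ j))
          -- The numbering of D supplies the decidable equality by which fixed letters are filtered
          -- out.
          (size-words _ (size-fixed (inj⇒≟ (Inv.Inverse⇒Injection D↔Fin)) Δ (lengthAt Δ j)) m)))))
    where
    open CycleDecomposition Δ using (cycles)
    factor : ℕ → ℕ
    factor k = ∑[1≤k≤ m ] (λ e → (∑∣ k (λ j → j * count Δ j)) ^ e)
    eq : product (tabulate (factor ∘ lengthAt Δ)) ≡ ∏∈ (cycleType Δ) factor
    eq = cong product (begin
      tabulate (factor ∘ lengthAt Δ)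
        ≡⟨ map-tabulate (lookup cycles) (factor ∘ List⁺.length) ⟨
      List.map (factor ∘ List⁺.length) (tabulate (lookup cycles))
        ≡⟨ cong (List.map _) (tabulate-lookup cycles) ⟩
      List.map (factor ∘ List⁺.length) cycles
        ≡⟨ map-∘ cycles ⟩
      List.map factor (cycleType Δ) ∎)
      where open ≡-Reasoning

-- Division in `ℚ` reduces fractions, so the equation is moved to unnormalised rationals, where it
-- is a cross multiplication. The second argument of `mkℚᵘ` is the denominator minus one.
average : ∀ N k T .{{_ : NonZero k}} → N * k ≡ T →
          (+ N) ℚ./ 1 ≡ ((+ 1) ℚ./ k) ℚ.* ((+ T) ℚ./ 1)
average N (suc k) T e = ℚ.toℚᵘ-injective (begin
  toℚᵘ ((+ N) ℚ./ 1)
    ≈⟨ ℚ.toℚᵘ-fromℚᵘ (mkℚᵘ (+ N) 0) ⟩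
  mkℚᵘ (+ N) 0
    ≈⟨ *≡* cross ⟩
  mkℚᵘ (+ 1) k ℚᵘ.* mkℚᵘ (+ T) 0
    ≈⟨ ℚᵘ.*-cong (ℚ.toℚᵘ-fromℚᵘ (mkℚᵘ (+ 1) k)) (ℚ.toℚᵘ-fromℚᵘ (mkℚᵘ (+ T) 0)) ⟨
  toℚᵘ ((+ 1) ℚ./ suc k) ℚᵘ.* toℚᵘ ((+ T) ℚ./ 1)
    ≈⟨ ℚ.toℚᵘ-homo-* ((+ 1) ℚ./ suc k) ((+ T) ℚ./ 1) ⟨
  toℚᵘ (((+ 1) ℚ./ suc k) ℚ.* ((+ T) ℚ./ 1)) ∎)
  where
  open ≈-Reasoning ℚᵘ.≃-setoid
  cross : (+ N) ℤ.* (+ (suc k * 1)) ≡ ((+ 1) ℤ.* (+ T)) ℤ.* (+ 1)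
  cross = ≡.begin
    (+ N) ℤ.* (+ (suc k * 1))      ≡.≡⟨ ℤ.pos-* N (suc k * 1) ⟨
    + (N * (suc k * 1))            ≡.≡⟨ cong (λ i → + (N * i)) (*-identityʳ (suc k)) ⟩
    + (N * suc k)                  ≡.≡⟨ cong +_ e ⟩
    + T                            ≡.≡⟨ ℤ.*-identityˡ (+ T) ⟨
    (+ 1) ℤ.* (+ T)                ≡.≡⟨ ℤ.*-identityʳ _ ⟨
    ((+ 1) ℤ.* (+ T)) ℤ.* (+ 1)    ≡.∎
    where module ≡ = ≡-Reasoning

theorem1 : ∀ {a} (n m : ℕ) → 1 ≤ n → 1 ≤ m → (D : Set a) → D ↔ Fin n →
    (g : Bijection (setoid (Fin (n !))) (Sym D)) →
    (decomposition : ∀ r → CycleDecomposition (Bijection.to g r)) →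
    let k = λ r → cycleType (decomposition r)
        c = λ r j → count (decomposition r) j
    in
    ∃[ N ]
      Bijection (EndomorphismClasses m D) (setoid (Fin N)) ×
      (+ N) ℚ./ 1 ≡
        ((+ 1) ℚ./ (n !)) {{n !≢0}} ℚ.*
        ((+ ∑Fin (n !) (λ r → ∏∈ (k r) (λ kᵢ → ∑[1≤k≤ m ] (λ e → (∑∣ kᵢ (λ j → j * c r j)) ^ e)))) ℚ./ 1)
theorem1 n m _ _ D D↔Fin g decomposition =
  -- Inverted, the enumeration `g` states that Sym(D) has size n!, with `Bijection.to g r` as the
  -- element numbered `r`, which is the one that `decomposition r` decomposes.
  conclude (burnside m D (Inv.sym (Bijection⇒Inverse g)) F
             (λ r → size-Fix m D D↔Fin (decomposition r)))
  where
  F : Fin (n !) → ℕ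
  F r = ∏∈ (cycleType (decomposition r))
             (λ k → ∑[1≤k≤ m ] (λ e → (∑∣ k (λ j → j * count (decomposition r) j)) ^ e))

  conclude : ∃[ N ] Orbits m D HasSize N × N * n ! ≡ ∑Fin (n !) F →
             ∃[ N ] Bijection (EndomorphismClasses m D) (setoid (Fin N)) ×
               (+ N) ℚ./ 1 ≡ ((+ 1) ℚ./ (n !)) {{n !≢0}} ℚ.* ((+ ∑Fin (n !) F) ℚ./ 1)
  conclude (N , size , eq) =
    N , Inv.Inverse⇒Bijection (Inv.trans (endomorphismClasses↔orbits m D) size) ,
    average N (n !) (∑Fin (n !) F) {{n !≢0}} eq
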